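{- Let $L$ be a tense logic extending $\mathsf{S4BP}^{2,\omega}_{2,2}$. Then $L\subseteq\mathsf{Ga}$ if and only if $\mathbf{bz}_n\notin L$ for every $n\in\mathbb{Z}^+$.
   Context: Tense formulas use $\Box$, $\Diamond=\neg\Box\neg$ and a past possibility operator written here $\mathsf{P}$; $\mathsf{S4}_t=\mathsf{K}_t\oplus\{\Box p\to p,\Box p\to\Box\Box p\}$. $\mathsf{S4BP}^{2,\omega}_{2,2}$ is $\mathsf{S4}_t$ extended by axioms bounding depth, forth-width and back-width by 2 ($\mathbf{bd}_2=\Diamond(\Box p_1\wedge\neg(\Diamond\Box p_0\to p_0))\to p_1$, $\mathbf{bw}^+_2=\bigwedge_{i\leq2}\Diamond p_i\to\bigvee_{i\neq j\leq2}\Diamond(p_i\wedge(p_j\vee\Diamond p_j))$, $\mathbf{bw}^-_2$ the same with $\mathsf{P}$ for $\Diamond$). Let $\Delta\phi=\phi\vee\Diamond\phi\vee\mathsf{P}\phi$, $\Delta^{n+1}\phi=\Delta\Delta^n\phi$, and $\mathbf{bz}_n=\Delta^{n+1}p\to\Delta^np$ (z-degree at most $n$: every point of a rooted frame reachable within $n$ forward/backward steps). Let $\mathfrak{G}_\mathbb{Z}=(\mathbb{Z},R_z)$ with $R_z=\{(i,i):i\in\mathbb{Z}\}\cup\{(2i+1,2i):i\in\mathbb{Z}\}\cup\{(2i+1,2i+2):i\in\mathbb{Z}\}$ and $\mathsf{Ga}=\mathsf{Log}(\mathfrak{G}_\mathbb{Z})$. -}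

module Defs where

open import Data.Nat using (ℕ; zero; suc)
open import Data.Integer using (ℤ; +_; _+_; _*_)
open import Data.Empty using (⊥)
open import Relation.Nullary using (¬_)

infixr 5 _⇒_

data Fm : Set where
  var : ℕ → Fm
  ⊥'  : Fm
  _⇒_ : Fm → Fm → Fm
  □   : Fm → Fm
  ■   : Fm → Fm

¬' : Fm → Fm
¬' φ = φ ⇒ ⊥'

_∨'_ : Fm → Fm → Fm
φ ∨' ψ = ¬' φ ⇒ ψ

_∧'_ : Fm → Fm → Fm
φ ∧' ψ = ¬' (φ ⇒ ¬' ψ)

◇ : Fm → Fm
◇ φ = ¬' (□ (¬' φ))

𝖯 : Fm → Fm
𝖯 φ = ¬' (■ (¬' φ))

_[_] : Fm → (ℕ → Fm) → Fm
var n [ σ ] = σ n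
⊥' [ σ ] = ⊥'
(φ ⇒ ψ) [ σ ] = (φ [ σ ]) ⇒ (ψ [ σ ])
□ φ [ σ ] = □ (φ [ σ ])
■ φ [ σ ] = ■ (φ [ σ ])

p q r : Fm
p = var 0
q = var 1
r = var 2

record TenseLogic (L : Fm → Set) : Set where
  field
    ax1   : L (p ⇒ (q ⇒ p))
    ax2   : L ((p ⇒ (q ⇒ r)) ⇒ ((p ⇒ q) ⇒ (p ⇒ r)))
    ax3   : L (¬' (¬' p) ⇒ p)
    axK□  : L (□ (p ⇒ q) ⇒ (□ p ⇒ □ q))
    axK■  : L (■ (p ⇒ q) ⇒ (■ p ⇒ ■ q))
    conv□ : L (p ⇒ □ (𝖯 p))
    conv■ : L (p ⇒ ■ (◇ p))
    mp    : ∀ {φ ψ} → L (φ ⇒ ψ) → L φ → L ψ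
    nec□  : ∀ {φ} → L φ → L (□ φ)
    nec■  : ∀ {φ} → L φ → L (■ φ)
    subst : ∀ {φ} (σ : ℕ → Fm) → L φ → L (φ [ σ ])

p₀ p₁ p₂ : Fm
p₀ = var 0
p₁ = var 1
p₂ = var 2

bd₂ : Fm
bd₂ = ◇ (□ p₁ ∧' ¬' (◇ (□ p₀) ⇒ p₀)) ⇒ p₁

bwWith : (Fm → Fm) → Fm
bwWith M =
  (M p₀ ∧' (M p₁ ∧' M p₂)) ⇒
  (d p₀ p₁ ∨' (d p₀ p₂ ∨' (d p₁ p₀ ∨' (d p₁ p₂ ∨' (d p₂ p₀ ∨' d p₂ p₁)))))
  where
  d : Fm → Fm → Fm
  d a b = M (a ∧' (b ∨' M b))

bw⁺₂ bw⁻₂ : Fm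
bw⁺₂ = bwWith ◇
bw⁻₂ = bwWith 𝖯

-- L extends S4BP^{2,ω}_{2,2} (the least tense logic containing these)
record ExtendsS4BP (L : Fm → Set) : Set where
  field
    tense : TenseLogic L
    axT   : L (□ p ⇒ p)
    ax4   : L (□ p ⇒ □ (□ p))
    axbd  : L bd₂
    axbw⁺ : L bw⁺₂
    axbw⁻ : L bw⁻₂

Δ : Fm → Fm
Δ φ = φ ∨' (◇ φ ∨' 𝖯 φ)

Δ^ : ℕ → Fm → Fm
Δ^ zero φ = φ
Δ^ (suc n) φ = Δ (Δ^ n φ)

bz : ℕ → Fm
bz n = Δ^ (suc n) p ⇒ Δ^ n p

data Rz : ℤ → ℤ → Set where
  rrefl : ∀ i → Rz i i
  rdown : ∀ k → Rz (+ 1 + + 2 * k) (+ 2 * k)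
  rup   : ∀ k → Rz (+ 1 + + 2 * k) (+ 2 + + 2 * k)

-- Kripke semantics (classical: atoms are read ¬¬-stably, and the
-- primitive connectives are all negative, so every sat is ¬¬-stable)
sat : (ℕ → ℤ → Set) → ℤ → Fm → Set
sat V x (var n) = ¬ ¬ V n x
sat V x ⊥' = ⊥
sat V x (φ ⇒ ψ) = sat V x φ → sat V x ψ
sat V x (□ φ) = ∀ y → Rz x y → sat V y φ
sat V x (■ φ) = ∀ y → Rz y x → sat V y φ

Ga : Fm → Set₁
Ga φ = ∀ (V : ℕ → ℤ → Set) (x : ℤ) → sat V x φ

{-# OPTIONS --safe #-}
module Submission where

-- If bz n ∉ L for all n, the canonical model of L contains a point at distance exactly N + 2 from the
-- set defined by p, for any N. Descending towards p gives a path whose edges alternate in direction,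
-- since two consecutive edges in the same direction would compose to a shortcut. By the depth and width
-- bounds the only neighbours of a cluster on this path are the adjacent clusters of the path, so around
-- its middle the model is boundedly bisimilar to 𝔊_ℤ. The distance to p is definable by Δ^ k p, hence
-- every valuation of a window of 𝔊_ℤ is imitated by a substitution, and theorems of L hold in 𝔊_ℤ.
-- Conversely, bz n fails in 𝔊_ℤ at 0 when p holds exactly at n + 1.
-- Everything is negative on both sides, so the classical steps take place under ¬¬.

open import Defs
open import Data.Bool using (Bool; true; false; not)
open import Data.Empty using (⊥; ⊥-elim)
open import Data.Integer as ℤ using (ℤ; +_; -[1+_]; ∣_∣)
import Data.Integer.Properties as ℤ
open import Data.List using (List; []; _∷_; _++_; map; cartesianProductWith)
open import Data.List.Membership.Propositional using (_∈_)
open import Data.List.Membership.Propositional.Properties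
  using (∈-map⁺; ∈-++⁺ˡ; ∈-++⁺ʳ; ∈-cartesianProductWith⁺)
open import Data.List.Relation.Unary.Any using (here; there)
open import Data.Nat as ℕ using (ℕ; zero; suc; _+_; _≤_; _<_; z≤n; s≤s)
import Data.Nat.Properties as ℕ
open import Data.Product using (Σ; ∃; _×_; _,_; proj₁; proj₂; swap)
open import Data.Sum as Sum using (_⊎_; inj₁; inj₂)
open import Function using (_∘_; flip; id)
open import Relation.Binary.PropositionalEquality
  using (_≡_; refl; sym; trans; cong; cong₂; subst; module ≡-Reasoning)
open import Relation.Nullary using (¬_; Dec; yes; no)
open import Relation.Nullary.Decidable using (¬¬-excluded-middle; decidable-stable)

-- Double negation and choice over finite ranges.

infixl 1 _>>=_
_>>=_ : ∀ {a b} {A : Set a} {B : Set b} → ¬ ¬ A → (A → ¬ ¬ B) → ¬ ¬ B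
(m >>= f) k = m λ x → f x k

return : ∀ {a} {A : Set a} → A → ¬ ¬ A
return x k = k x

-- Double-negation shift, constructive because the range is finite. The range will be the variables
-- of a single formula.
¬¬-bounded-∀ : ∀ {a} (P : ℕ → Set a) n → (∀ k → ¬ ¬ P k) → ¬ ¬ (∀ k → k < n → P k)
¬¬-bounded-∀ P zero    h = return λ _ ()
¬¬-bounded-∀ P (suc n) h = ¬¬-bounded-∀ P n h >>= λ below → h n >>= λ last →
  return λ k k<1+n → case-≤ k (ℕ.≤-pred k<1+n) below last
  where
  case-≤ : ∀ k → k ≤ n → (∀ j → j < n → P j) → P n → P k
  case-≤ k k≤n below last with ℕ.m≤n⇒m<n∨m≡n k≤n
  ... | inj₁ k<n  = below k k<n
  ... | inj₂ refl = last

extract : ∀ {a} (P : ℕ → Fm → Set a) n → (∀ v → v < n → Σ Fm (P v)) →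
          Σ (ℕ → Fm) λ σ → ∀ v → v < n → P v (σ v)
extract P n h = (λ v → pick v (v ℕ.<? n)) , λ v v<n → pick-spec v (v ℕ.<? n) v<n
  where
  pick : ∀ v → Dec (v < n) → Fm
  pick v (yes v<n) = proj₁ (h v v<n)
  -- A default for variables beyond the bound, which do not occur in the formula that is substituted
  -- into.
  pick v (no _)    = ⊥'
  pick-spec : ∀ v (d : Dec (v < n)) → v < n → P v (pick v d)
  pick-spec v (yes v<n) _   = proj₂ (h v v<n)
  pick-spec v (no v≮n)  v<n = ⊥-elim (v≮n v<n)

-- Increasing finite lists that together exhaust `Fm`; they replace a coding of formulas by numbers.
formulas : ℕ → List Fm
formulas zero    = []
formulas (suc n) =
  formulas n ++ var n ∷ ⊥' ∷
  map □ (formulas n) ++ map ■ (formulas n) ++ cartesianProductWith _⇒_ (formulas n) (formulas n)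

formulas-mono : ∀ {φ} m n → φ ∈ formulas n → φ ∈ formulas (m + n)
formulas-mono zero    n h = h
formulas-mono (suc m) n h = ∈-++⁺ˡ (formulas-mono m n h)

formulas-complete : ∀ φ → ∃ λ n → φ ∈ formulas n
formulas-complete (var n) = suc n , ∈-++⁺ʳ (formulas n) (here refl)
formulas-complete ⊥' = 1 , there (here refl)
formulas-complete (φ ⇒ ψ) with formulas-complete φ | formulas-complete ψ
... | m , φ∈ | n , ψ∈ = suc (m + n) ,
  ∈-++⁺ʳ (formulas (m + n)) (there (there (∈-++⁺ʳ (map □ (formulas (m + n)))
    (∈-++⁺ʳ (map ■ (formulas (m + n)))
      (∈-cartesianProductWith⁺ _⇒_
        (subst (λ k → φ ∈ formulas k) (ℕ.+-comm n m) (formulas-mono n m φ∈))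
        (formulas-mono m n ψ∈))))))
formulas-complete (□ φ) with formulas-complete φ
... | n , φ∈ = suc n , ∈-++⁺ʳ (formulas n) (there (there (∈-++⁺ˡ (∈-map⁺ □ φ∈))))
formulas-complete (■ φ) with formulas-complete φ
... | n , φ∈ = suc n , ∈-++⁺ʳ (formulas n)
  (there (there (∈-++⁺ʳ (map □ (formulas n)) (∈-++⁺ˡ (∈-map⁺ ■ φ∈)))))

instantiate : Fm → Fm → Fm → ℕ → Fm
instantiate φ ψ χ 0 = φ
instantiate φ ψ χ 1 = ψ
instantiate φ ψ χ _ = χ

-- Derivations, maximal consistent theories and the Lindenbaum construction.

module Canonical (L : Fm → Set) (tense : TenseLogic L) where
  open TenseLogic tense hiding (subst)

  K : ∀ φ ψ → L (φ ⇒ ψ ⇒ φ)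
  K φ ψ = TenseLogic.subst tense (instantiate φ ψ ψ) ax1

  S : ∀ φ ψ χ → L ((φ ⇒ ψ ⇒ χ) ⇒ (φ ⇒ ψ) ⇒ φ ⇒ χ)
  S φ ψ χ = TenseLogic.subst tense (instantiate φ ψ χ) ax2

  dne : ∀ φ → L (¬' (¬' φ) ⇒ φ)
  dne φ = TenseLogic.subst tense (λ _ → φ) ax3

  infix 4 _⊢_
  -- Necessitation acts only inside `L`, through `thm`; this is what makes the deduction theorem
  -- hold.
  data _⊢_ (T : Fm → Set) : Fm → Set where
    hyp : ∀ {φ} → T φ → T ⊢ φ
    thm : ∀ {φ} → L φ → T ⊢ φ
    app : ∀ {φ ψ} → T ⊢ φ ⇒ ψ → T ⊢ φ → T ⊢ ψ

  ext : (Fm → Set) → Fm → Fm → Set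
  ext T χ φ = T φ ⊎ φ ≡ χ

  Con : (Fm → Set) → Set
  Con T = ¬ (T ⊢ ⊥')

  ⊢-mono : ∀ {T T′ φ} → (∀ ψ → T ψ → T′ ψ) → T ⊢ φ → T′ ⊢ φ
  ⊢-mono f (hyp h)   = hyp (f _ h)
  ⊢-mono f (thm h)   = thm h
  ⊢-mono f (app d e) = app (⊢-mono f d) (⊢-mono f e)

  deduce : ∀ {T χ φ} → ext T χ ⊢ φ → T ⊢ χ ⇒ φ
  deduce {χ = χ} (hyp (inj₁ h))    = app (thm (K _ χ)) (hyp h)
  deduce {χ = χ} (hyp (inj₂ refl)) = app (app (thm (S χ (χ ⇒ χ) χ)) (thm (K χ (χ ⇒ χ)))) (thm (K χ χ))
  deduce {χ = χ} (thm h)           = app (thm (K _ χ)) (thm h)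
  deduce (app d e)                 = app (app (thm (S _ _ _)) (deduce d)) (deduce e)

  ⊢-exfalso : ∀ {T} φ → T ⊢ ⊥' ⇒ φ
  ⊢-exfalso φ = deduce (app (thm (dne φ)) (app (thm (K ⊥' (¬' φ))) (hyp (inj₂ refl))))

  -- Maximal consistent theories. Maximality yields a negation from mere non-membership, so that
  -- membership is stable under ¬¬ without being decidable.
  record World : Set₁ where
    field
      Mem        : Fm → Set
      theorems   : ∀ {φ} → L φ → Mem φ
      mp-closed  : ∀ {φ ψ} → Mem (φ ⇒ ψ) → Mem φ → Mem ψ
      consistent : ¬ Mem ⊥'
      maximal    : ∀ {φ} → ¬ Mem φ → Mem (¬' φ)
  open World public

  infix 4 _∋_
  _∋_ : World → Fm → Set
  w ∋ φ = Mem w φ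

  -- Only formulas consistent with the current theory are added; consistency is undecidable, so the
  -- decision is recorded inside the predicate and the limit theory is closed under ¬¬.
  add : (Fm → Set) → Fm → Fm → Set
  add T χ φ = T φ ⊎ (φ ≡ χ × Con (ext T χ))

  addAll : (Fm → Set) → List Fm → Fm → Set
  addAll T []       = T
  addAll T (χ ∷ χs) = addAll (add T χ) χs

  -- A contradiction in `add T χ` makes `ext T χ` inconsistent. Then the recorded side condition is
  -- false, nothing was added, and the contradiction already comes from `T`.
  add-con : ∀ {T} χ → Con T → Con (add T χ)
  add-con {T} χ con d = inconsistent λ e → con (⊢-mono (drop (λ c → c e)) d)
    where
    inconsistent : ¬ Con (ext T χ)
    inconsistent c = c (⊢-mono (λ { _ (inj₁ h) → inj₁ h ; _ (inj₂ (eq , _)) → inj₂ eq }) d)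
    drop : ¬ Con (ext T χ) → ∀ φ → add T χ φ → T φ
    drop ¬c φ (inj₁ h)       = h
    drop ¬c φ (inj₂ (_ , c)) = ⊥-elim (¬c c)

  addAll-con : ∀ {T} χs → Con T → Con (addAll T χs)
  addAll-con []       con = con
  addAll-con (χ ∷ χs) con = addAll-con χs (add-con χ con)

  addAll-⊇ : ∀ {T} χs φ → T φ → addAll T χs φ
  addAll-⊇ []       φ h = h
  addAll-⊇ (χ ∷ χs) φ h = addAll-⊇ χs φ (inj₁ h)

  -- When its turn came, `φ` must have been inconsistent with the theory built so far, as it would
  -- have been added otherwise; the deduction theorem then derives its negation.
  addAll-decides : ∀ {T φ} χs → φ ∈ χs → ¬ (addAll T χs ⊢ φ) → ¬ ¬ (addAll T χs ⊢ ¬' φ)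
  addAll-decides (χ ∷ χs) (there φ∈) h = addAll-decides χs φ∈ h
  addAll-decides {T} {φ} (φ ∷ χs) (here refl) h k =
    ¬con λ d → k (⊢-mono (addAll-⊇ χs) (⊢-mono (λ _ → inj₁) (deduce d)))
    where
    ¬con : ¬ Con (ext T φ)
    ¬con c = h (hyp (addAll-⊇ χs φ (inj₂ (refl , c))))

  module Lindenbaum (T : Fm → Set) (T-con : Con T) where
    stage : ℕ → Fm → Set
    stage zero    = T
    stage (suc n) = addAll (stage n) (formulas n)

    stage-con : ∀ n → Con (stage n)
    stage-con zero    = T-con
    stage-con (suc n) = addAll-con (formulas n) (stage-con n)

    stage-mono : ∀ m n φ → stage n φ → stage (m + n) φ
    stage-mono zero    n φ h = h
    stage-mono (suc m) n φ h = addAll-⊇ (formulas (m + n)) φ (stage-mono m n φ h)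

    limit : World
    limit .Mem φ = ¬ ¬ ∃ λ n → stage n ⊢ φ
    limit .theorems h = return (0 , thm h)
    limit .mp-closed {φ} {ψ} d e = d >>= λ { (m , d) → e >>= λ { (n , e) →
      return (n + m , app (⊢-mono (stage-mono n m) d)
        (subst (λ k → stage k ⊢ φ) (ℕ.+-comm m n) (⊢-mono (stage-mono m n) e))) } }
    limit .consistent h = h λ { (n , d) → stage-con n d }
    limit .maximal {φ} h with formulas-complete φ
    ... | n , φ∈ = addAll-decides (formulas n) φ∈ (λ d → h (return (suc n , d))) >>= λ d →
      return (suc n , d)

    limit-⊇ : ∀ φ → T φ → limit ∋ φ
    limit-⊇ φ h = return (0 , hyp h)

  ∋-stable : ∀ w {φ} → ¬ ¬ (w ∋ φ) → w ∋ φ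
  ∋-stable w {φ} h = mp-closed w (theorems w (dne φ))
    (maximal w λ n → h λ d → consistent w (mp-closed w n d))

  ∋-⊢ : ∀ w {T φ} → (∀ ψ → T ψ → w ∋ ψ) → T ⊢ φ → w ∋ φ
  ∋-⊢ w h (hyp t)   = h _ t
  ∋-⊢ w h (thm l)   = theorems w l
  ∋-⊢ w h (app d e) = mp-closed w (∋-⊢ w h d) (∋-⊢ w h e)

  ¬-elim : ∀ w {φ} → w ∋ ¬' φ → ¬ (w ∋ φ)
  ¬-elim w n d = consistent w (mp-closed w n d)

  ⇒-intro : ∀ w {φ ψ} → (w ∋ φ → w ∋ ψ) → w ∋ φ ⇒ ψ
  ⇒-intro w {φ} {ψ} f = ∋-stable w λ n → n (from-¬φ (maximal w λ d → n (mp-closed w (theorems w (K ψ φ)) (f d))))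
    where
    from-¬φ : w ∋ ¬' φ → w ∋ φ ⇒ ψ
    from-¬φ d = ∋-⊢ w {ext (λ _ → ⊥) (¬' φ)} (λ { _ (inj₂ refl) → d })
      (deduce (app (⊢-exfalso ψ) (app (hyp (inj₁ (inj₂ refl))) (hyp (inj₂ refl)))))

  ∨-elim : ∀ w {φ ψ} → w ∋ φ ∨' ψ → ¬ (w ∋ φ) → ¬ ¬ (w ∋ ψ)
  ∨-elim w d nφ = return (mp-closed w d (maximal w nφ))

  ∨-introˡ : ∀ w {φ ψ} → w ∋ φ → w ∋ φ ∨' ψ
  ∨-introˡ w d = ⇒-intro w λ n → ⊥-elim (¬-elim w n d)

  ∨-introʳ : ∀ w {φ ψ} → w ∋ ψ → w ∋ φ ∨' ψ
  ∨-introʳ w d = ⇒-intro w λ _ → d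

  ∧-intro : ∀ w {φ ψ} → w ∋ φ → w ∋ ψ → w ∋ φ ∧' ψ
  ∧-intro w d e = maximal w λ n → ¬-elim w (mp-closed w n d) e

  ∧-elimˡ : ∀ w {φ ψ} → w ∋ φ ∧' ψ → w ∋ φ
  ∧-elimˡ w d = ∋-stable w λ n → ¬-elim w d (⇒-intro w λ e → ⊥-elim (n e))

  ∧-elimʳ : ∀ w {φ ψ} → w ∋ φ ∧' ψ → w ∋ ψ
  ∧-elimʳ w d = ∋-stable w λ n → ¬-elim w d (⇒-intro w λ _ → maximal w n)

  consistent⇒world : ∀ φ → ¬ L φ → Σ World λ w → ¬ (w ∋ φ)
  consistent⇒world φ ¬Lφ = limit , λ d → ¬-elim limit (limit-⊇ (¬' φ) (inj₂ refl)) d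
    where
    closed : ∀ {ψ} → (λ _ → ⊥) ⊢ ψ → L ψ
    closed (thm l)   = l
    closed (app d e) = mp (closed d) (closed e)
    open Lindenbaum (ext (λ _ → ⊥) (¬' φ)) (λ d → ¬Lφ (mp (dne φ) (closed (deduce d))))

  bwInstance : (Fm → Fm) → Fm → Fm → Fm → Fm
  bwInstance M φ ψ χ =
    (M φ ∧' (M ψ ∧' M χ)) ⇒
    (d φ ψ ∨' (d φ χ ∨' (d ψ φ ∨' (d ψ χ ∨' (d χ φ ∨' d χ ψ)))))
    where
    d : Fm → Fm → Fm
    d φ ψ = M (φ ∧' (ψ ∨' M ψ))

  -- Canonical accessibility for one box, used for both future and past.

  module Modality (box : Fm → Fm) (nec : ∀ {φ} → L φ → L (box φ))
                  (distr : ∀ φ ψ → L (box (φ ⇒ ψ) ⇒ (box φ ⇒ box ψ))) where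
    record Rel (x y : World) : Set where
      constructor rel
      field transfer : ∀ φ → x ∋ box φ → y ∋ φ
    open Rel public

    dia : Fm → Fm
    dia φ = ¬' (box (¬' φ))

    -- If `box φ` were missing, the formulas boxed at `x` together with `¬' φ` would be consistent,
    -- since a refutation could be boxed inside `x`. Their limit would be a successor without `φ`.
    box-intro : ∀ x {φ} → (∀ y → Rel x y → y ∋ φ) → x ∋ box φ
    box-intro x {φ} h = ∋-stable x refute
      where
      boxed : ∀ {ψ} → (λ ψ → x ∋ box ψ) ⊢ ψ → x ∋ box ψ
      boxed (hyp d)   = d
      boxed (thm l)   = theorems x (nec l)
      boxed (app d e) = mp-closed x (mp-closed x (theorems x (distr _ _)) (boxed d)) (boxed e)
      refute : ¬ ¬ (x ∋ box φ)
      refute n = ¬-elim limit (limit-⊇ (¬' φ) (inj₂ refl)) (h limit (rel λ ψ d → limit-⊇ ψ (inj₁ d)))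
        where open Lindenbaum (ext (λ ψ → x ∋ box ψ) (¬' φ)) (λ d → n (boxed (app (thm (dne φ)) (deduce d))))

    dia-intro : ∀ x y {φ} → Rel x y → y ∋ φ → x ∋ dia φ
    dia-intro x y r d = maximal x λ b → ¬-elim y (transfer r _ b) d

    dia-elim : ∀ x {φ} → x ∋ dia φ → ¬ (∀ y → Rel x y → ¬ (y ∋ φ))
    dia-elim x d h = ¬-elim x d (box-intro x λ y r → maximal y (h y r))

    Rel-stable : ∀ x y → ¬ ¬ Rel x y → Rel x y
    Rel-stable x y h = rel λ φ d → ∋-stable y λ n → h λ r → n (transfer r φ d)

    separate : ∀ x y → ¬ Rel x y → ¬ ¬ Σ Fm λ φ → x ∋ box φ × ¬ (y ∋ φ)
    separate x y ¬r h = ¬r (rel λ φ d → ∋-stable y λ n → h (φ , d , n))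

    -- Refutes one disjunct of a width axiom: `box χ` puts `χ` at the point itself, by reflexivity,
    -- and at its successors, while `ψ` rules `χ` out.
    exclude : ∀ {φ ψ χ} → (∀ v → Rel v v) → (∀ v → v ∋ φ → v ∋ box χ) → (∀ v → v ∋ ψ → ¬ (v ∋ χ)) →
              ∀ x → ¬ (x ∋ dia (φ ∧' (ψ ∨' dia ψ)))
    exclude rel-refl f g x d = dia-elim x d λ v _ e →
      ∨-elim v (∧-elimʳ v e) (λ ψv → g v ψv (transfer (rel-refl v) _ (f v (∧-elimˡ v e)))) λ e′ →
      dia-elim v e′ λ u r ψu → g u ψu (transfer r _ (f v (∧-elimˡ v e)))

    width : (∀ v → Rel v v) → (∀ φ ψ χ → L (bwInstance dia φ ψ χ)) →
            ∀ x a b c → Rel x a → Rel x b → Rel x c →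
            ¬ Rel a b → ¬ Rel a c → ¬ Rel b a → ¬ Rel b c → ¬ Rel c a → ¬ Rel c b → ⊥
    width rel-refl bw x a b c ra rb rc nab nac nba nbc nca ncb =
      separate a b nab λ { (ab , ab₁ , ab₂) → separate a c nac λ { (ac , ac₁ , ac₂) →
      separate b a nba λ { (ba , ba₁ , ba₂) → separate b c nbc λ { (bc , bc₁ , bc₂) →
      separate c a nca λ { (ca , ca₁ , ca₂) → separate c b ncb λ { (cb , cb₁ , cb₂) →
      -- The formula `ab` is boxed at `a` and absent from `b`, and similarly for the other five.
      -- Each of `α`, `β`, `γ` boxes what separates its own point from the other two and negates
      -- what separates those from it, so every disjunct of the axiom is excluded.
      let α = box ab ∧' (box ac ∧' (¬' ba ∧' ¬' ca))
          β = box ba ∧' (box bc ∧' (¬' ab ∧' ¬' cb))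
          γ = box ca ∧' (box cb ∧' (¬' ac ∧' ¬' bc))
          1st = λ {φ ψ χ ω : Fm} v (d : v ∋ φ ∧' (ψ ∧' (χ ∧' ω))) → ∧-elimˡ v d
          2nd = λ {φ ψ χ ω : Fm} v (d : v ∋ φ ∧' (ψ ∧' (χ ∧' ω))) → ∧-elimˡ v (∧-elimʳ v d)
          3rd = λ {φ ψ χ ω : Fm} v (d : v ∋ φ ∧' (ψ ∧' (¬' χ ∧' ω))) →
                  ¬-elim v (∧-elimˡ v (∧-elimʳ v (∧-elimʳ v d)))
          4th = λ {φ ψ χ ω : Fm} v (d : v ∋ φ ∧' (ψ ∧' (χ ∧' ¬' ω))) →
                  ¬-elim v (∧-elimʳ v (∧-elimʳ v (∧-elimʳ v d)))
          conj = λ y {φ ψ χ ω : Fm} (d₁ : y ∋ φ) (d₂ : y ∋ ψ) (d₃ : ¬ (y ∋ χ)) (d₄ : ¬ (y ∋ ω)) →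
                  ∧-intro y d₁ (∧-intro y d₂ (∧-intro y (maximal y d₃) (maximal y d₄)))
      in ∨-elim x (mp-closed x (theorems x (bw α β γ))
           (∧-intro x (dia-intro x a ra (conj a ab₁ ac₁ ba₂ ca₂))
             (∧-intro x (dia-intro x b rb (conj b ba₁ bc₁ ab₂ cb₂))
                        (dia-intro x c rc (conj c ca₁ cb₁ ac₂ bc₂)))))
           (exclude rel-refl 1st 3rd x) λ d →
         ∨-elim x d (exclude rel-refl 2nd 3rd x) λ d →
         ∨-elim x d (exclude rel-refl 1st 3rd x) λ d →
         ∨-elim x d (exclude rel-refl 2nd 4th x) λ d →
         ∨-elim x d (exclude rel-refl 1st 4th x)
           (exclude rel-refl 2nd 4th x) } } } } } }

-- Forks and their back-and-forth property, in either direction.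

dir : ∀ {a} {X : Set a} → Bool → (X → X → Set) → X → X → Set
dir true  S = S
dir false S = flip S

-- B is the middle point of a fork A ← B → C, up to clusters.
record Fork {a} {X : Set a} (S : X → X → Set) (A B C : X → Set) : Set a where
  field
    below  : ∀ {w y} → B w → S y w → B y
    above  : ∀ {w y} → B w → S w y → ¬ ¬ (A y ⊎ B y ⊎ C y)
    left   : ∀ {w} → B w → Σ X λ y → A y × S w y
    centre : ∀ {w} → B w → S w w
    right  : ∀ {w} → B w → Σ X λ y → C y × S w y

module _ {a b} {X : Set a} {Y : Set b} {S : X → X → Set} {T : Y → Y → Set}
         {A B C : X → Set} {A′ B′ C′ : Y → Set} where

  -- A move out of the middle lands in one of three classes, and the other fork has a reachable
  -- point in the corresponding class.
  respond-above : Fork S A B C → Fork T A′ B′ C′ → ∀ {w w′ y} → B w → B′ w′ → S w y →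
                  ¬ ¬ Σ Y λ y′ → T w′ y′ × ((A y × A′ y′) ⊎ (B y × B′ y′) ⊎ (C y × C′ y′))
  respond-above F G {w′ = w′} Bw Bw′ s = Fork.above F Bw s >>= λ
    { (inj₁ Ay)        → let y′ , A′y′ , t = Fork.left G Bw′ in return (y′ , t , inj₁ (Ay , A′y′))
    ; (inj₂ (inj₁ By)) → return (w′ , Fork.centre G Bw′ , inj₂ (inj₁ (By , Bw′)))
    ; (inj₂ (inj₂ Cy)) → let y′ , C′y′ , t = Fork.right G Bw′ in return (y′ , t , inj₂ (inj₂ (Cy , C′y′))) }

  -- Nothing lies strictly below the middle of a fork, so the answer is to stay in place.
  respond-below : Fork S A B C → Fork T A′ B′ C′ → ∀ {w w′ y} → B w → B′ w′ → S y w →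
                  ¬ ¬ Σ Y λ y′ → T y′ w′ × ((A y × A′ y′) ⊎ (B y × B′ y′) ⊎ (C y × C′ y′))
  respond-below F G {w′ = w′} Bw Bw′ s =
    return (w′ , Fork.centre G Bw′ , inj₂ (inj₁ (Fork.below F Bw s , Bw′)))

module _ {a b} {X : Set a} {Y : Set b} {S : X → X → Set} {T : Y → Y → Set}
         {A B C : X → Set} {A′ B′ C′ : Y → Set} where

  respond-forward : ∀ c → Fork (dir c S) A B C → Fork (dir c T) A′ B′ C′ →
                    ∀ {w w′ y} → B w → B′ w′ → S w y → ¬ ¬ Σ Y λ y′ → T w′ y′ ×
                    ((A y × A′ y′) ⊎ (B y × B′ y′) ⊎ (C y × C′ y′))
  respond-forward true  F G = respond-above F G
  respond-forward false F G = respond-below F G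

  respond-backward : ∀ c → Fork (dir c S) A B C → Fork (dir c T) A′ B′ C′ →
                     ∀ {w w′ y} → B w → B′ w′ → S y w → ¬ ¬ Σ Y λ y′ → T y′ w′ ×
                     ((A y × A′ y′) ⊎ (B y × B′ y′) ⊎ (C y × C′ y′))
  respond-backward true  F G = respond-below F G
  respond-backward false F G = respond-above F G

dir-not : ∀ {a} {X : Set a} {S : X → X → Set} c {x y} → dir c S x y → dir (not c) S y x
dir-not true  s = s
dir-not false s = s

dir-cases : ∀ {a} {X : Set a} {S : X → X → Set} c {x y} → S x y ⊎ S y x → dir c S x y ⊎ dir (not c) S x y
dir-cases true  s        = s
dir-cases false (inj₁ s) = inj₂ s
dir-cases false (inj₂ s) = inj₁ s

dir-adjacent : ∀ {a} {X : Set a} {S : X → X → Set} c {x y} → dir c S x y → S x y ⊎ S y x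
dir-adjacent true  = inj₁
dir-adjacent false = inj₂

orient : Bool → ℕ → Bool
orient c zero    = c
orient c (suc j) = not (orient c j)

-- What the axioms say of accessibility and of its converse alike: no strict chain of three points
-- and no three pairwise unrelated successors. The relation `E` is a separate parameter so that both
-- directions share literally the same clusters.
record Bounded {a} {X : Set a} (S E : X → X → Set) : Set a where
  field
    E-to    : ∀ {x y} → E x y → S x y
    E-from  : ∀ {x y} → E x y → S y x
    E-intro : ∀ {x y} → S x y → S y x → E x y
    S-refl  : ∀ {x} → S x x
    S-trans : ∀ {x y z} → S x y → S y z → S x z
    stable  : ∀ {x y} → ¬ ¬ S x y → S x y
    depth   : ∀ {x y z} → S x y → S y z → ¬ S y x → ¬ S z y → ⊥
    width   : ∀ {x a b c} → S x a → S x b → S x c →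
              ¬ S a b → ¬ S a c → ¬ S b a → ¬ S b c → ¬ S c a → ¬ S c b → ⊥

-- A point strictly below `v` would start a strict chain of three through `u`. A successor of `v`
-- outside all three clusters would, by depth, be unrelated to `u` and `w`, against width.
bounded⇒fork : ∀ {a} {X : Set a} {S E : X → X → Set} → Bounded S E → ∀ {u v w} →
               S v u → S v w → ¬ S u w → ¬ S w u → Fork S (λ x → E x u) (λ x → E x v) (λ x → E x w)
bounded⇒fork {S = S} {E} bounded {u} {v} {w} vu vw ¬uw ¬wu = record
  { below  = λ {x} {y} xv yx → let yv = S-trans yx (E-to xv) in
      E-intro yv (stable λ ¬vy → depth yv vu ¬vy ¬uv)
  ; above  = λ {x} {y} xv xy k → above (S-trans (E-from xv) xy) k
  ; left   = λ xv → u , E-intro S-refl S-refl , S-trans (E-to xv) vu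
  ; centre = λ _ → S-refl
  ; right  = λ xv → w , E-intro S-refl S-refl , S-trans (E-to xv) vw
  }
  where
  open Bounded bounded
  ¬uv : ¬ S u v
  ¬uv uv = ¬uw (S-trans uv vw)
  ¬wv : ¬ S w v
  ¬wv wv = ¬wu (S-trans wv vu)
  above : ∀ {y} → S v y → ¬ ¬ (E y u ⊎ E y v ⊎ E y w)
  above {y} vy k = width vu vw vy ¬uw ¬uy ¬wu ¬wy ¬yu ¬yw
    where
    ¬yv : ¬ S y v
    ¬yv yv = k (inj₂ (inj₁ (E-intro yv vy)))
    ¬yu : ¬ S y u
    ¬yu yu = depth vy yu ¬yv λ uy → k (inj₁ (E-intro yu uy))
    ¬yw : ¬ S y w
    ¬yw yw = depth vy yw ¬yv λ wy → k (inj₂ (inj₂ (E-intro yw wy)))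
    ¬uy : ¬ S u y
    ¬uy uy = depth vu uy ¬uv ¬yu
    ¬wy : ¬ S w y
    ¬wy wy = depth vw wy ¬wv ¬yw

-- Parity of integers and the forks of 𝔊_ℤ.

next : ℤ → ℤ
next a = + 1 ℤ.+ a

next-injective : ∀ {a b} → next a ≡ next b → a ≡ b
next-injective {a} {b} eq = trans (sym (ℤ.pred-suc a)) (trans (cong ℤ.pred eq) (ℤ.pred-suc b))

+-next : ∀ z j → z ℤ.+ + suc j ≡ next (z ℤ.+ + j)
+-next z j = trans (sym (ℤ.+-assoc z (+ 1) (+ j)))
  (trans (cong (ℤ._+ + j) (ℤ.+-comm z (+ 1))) (ℤ.+-assoc (+ 1) z (+ j)))

∣next∣-near : ∀ a → ∣ a ∣ ≤ suc ∣ next a ∣ × ∣ next a ∣ ≤ suc ∣ a ∣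
∣next∣-near (+ n)        = ℕ.≤-trans (ℕ.n≤1+n n) (ℕ.n≤1+n (suc n)) , ℕ.≤-refl
∣next∣-near -[1+ zero ]  = ℕ.≤-refl , z≤n
∣next∣-near -[1+ suc n ] = ℕ.≤-refl , ℕ.≤-trans (ℕ.n≤1+n _) (ℕ.n≤1+n _)

-- Odd points see both neighbours, so `true` stands for odd, in agreement with `dir true`.
HasParity : Bool → ℤ → Set
HasParity true  a = Σ ℤ λ k → a ≡ next (+ 2 ℤ.* k)
HasParity false a = Σ ℤ λ k → a ≡ + 2 ℤ.* k

two-plus : ∀ k → + 2 ℤ.+ + 2 ℤ.* k ≡ next (next (+ 2 ℤ.* k))
two-plus k = ℤ.+-assoc (+ 1) (+ 1) (+ 2 ℤ.* k)

double-next : ∀ k → + 2 ℤ.* next k ≡ next (next (+ 2 ℤ.* k))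
double-next k = trans (ℤ.*-suc (+ 2) k) (two-plus k)

parity-next : ∀ c {a} → HasParity c a → HasParity (not c) (next a)
parity-next true  (k , eq) = next k , trans (cong next eq) (sym (double-next k))
parity-next false (k , eq) = k , cong next eq

parity-previous : ∀ c {a} → HasParity c (next a) → HasParity (not c) a
parity-previous true  (k , eq) = k , next-injective eq
parity-previous false (k , eq) = ℤ.pred k ,
  next-injective (trans eq (trans (cong (+ 2 ℤ.*_) (sym (ℤ.suc-pred k))) (double-next (ℤ.pred k))))

parity : ∀ a → Σ Bool λ c → HasParity c a
parity (+ zero)       = false , + 0 , refl
parity (+ suc n)      = let c , h = parity (+ n) in not c , parity-next c h
parity -[1+ zero ]    = true , -[1+ 0 ] , refl
parity -[1+ suc n ]   = let c , h = parity -[1+ n ] in not c , parity-previous c h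

double≢1 : ∀ k → ¬ (+ 2 ℤ.* k ≡ + 1)
double≢1 k eq with trans (sym (ℤ.abs-* (+ 2) k)) (cong ∣_∣ eq)
... | eq′ with ∣ k ∣
...   | suc n with trans (sym (ℕ.+-suc n (n + 0))) (ℕ.suc-injective eq′)
...     | ()

odd≢even : ∀ k l → ¬ (next (+ 2 ℤ.* k) ≡ + 2 ℤ.* l)
odd≢even k l eq = double≢1 (l ℤ.- k) (begin
  + 2 ℤ.* (l ℤ.- k)                       ≡⟨ ℤ.*-distribˡ-+ (+ 2) l (ℤ.- k) ⟩
  + 2 ℤ.* l ℤ.+ + 2 ℤ.* (ℤ.- k)           ≡⟨ cong₂ ℤ._+_ (sym eq) (sym (ℤ.neg-distribʳ-* (+ 2) k)) ⟩
  next (+ 2 ℤ.* k) ℤ.- + 2 ℤ.* k          ≡⟨ ℤ.+-assoc (+ 1) (+ 2 ℤ.* k) _ ⟩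
  + 1 ℤ.+ (+ 2 ℤ.* k ℤ.- + 2 ℤ.* k)       ≡⟨ cong next (ℤ.+-inverseʳ (+ 2 ℤ.* k)) ⟩
  + 1                                     ∎)
  where open ≡-Reasoning

-- An odd point sees both neighbours and is seen only by itself; at an even point the roles are
-- reversed. Edges of the wrong parity are excluded by `odd≢even`.
Rz-fork : ∀ c a → HasParity c (next a) → Fork (dir c Rz) (_≡ a) (_≡ next a) (_≡ next (next a))
Rz-fork true a (k , eq) with refl ← next-injective {a} {+ 2 ℤ.* k} eq = record
  { below  = λ { b≡ (rrefl _) → b≡
               ; b≡ (rdown l) → ⊥-elim (odd≢even k l (sym b≡))
               ; b≡ (rup l) → ⊥-elim (odd≢even k (next l) (trans (sym b≡) (trans (two-plus l) (sym (double-next l))))) }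
  ; above  = λ { b≡ (rrefl _) → return (inj₂ (inj₁ b≡))
               ; b≡ (rdown l) → return (inj₁ (next-injective b≡))
               ; b≡ (rup l) → return (inj₂ (inj₂ (trans (two-plus l) (cong next b≡)))) }
  ; left   = λ { refl → + 2 ℤ.* k , refl , rdown k }
  ; centre = λ _ → rrefl _
  ; right  = λ { refl → + 2 ℤ.+ + 2 ℤ.* k , two-plus k , rup k }
  }
Rz-fork false a (k , eq) = record
  { below  = λ { b≡ (rrefl _) → b≡
               ; b≡ (rdown l) → ⊥-elim (odd≢even l k (trans b≡ eq))
               ; b≡ (rup l) → ⊥-elim (odd≢even l k (trans b≡ eq)) }
  ; above  = λ { b≡ (rrefl _) → return (inj₂ (inj₁ b≡))
               ; b≡ (rdown l) → return (inj₂ (inj₂ (cong next b≡)))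
               ; b≡ (rup l) → return (inj₁ (next-injective (trans (sym (two-plus l)) b≡))) }
  ; left   = λ { refl → a , refl , left }
  ; centre = λ _ → rrefl _
  ; right  = λ { refl → next (next a) , refl , right }
  }
  where
  left : Rz a (next a)
  left with l , refl ← parity-previous false {a} (k , eq) =
    subst (Rz (next (+ 2 ℤ.* l))) (two-plus l) (rup l)
  right : Rz (next (next a)) (next a)
  right = subst (λ b → Rz (next b) b) (sym eq) (rdown k)

parity-orient : ∀ c z → HasParity c z → ∀ j → HasParity (orient c j) (z ℤ.+ + j)
parity-orient c z h zero    = subst (HasParity c) (sym (ℤ.+-identityʳ z)) h
parity-orient c z h (suc j) = subst (HasParity (not (orient c j))) (sym (+-next z j))
  (parity-next (orient c j) (parity-orient c z h j))

Rz-near : ∀ {a b} → Rz a b → ∣ a ∣ ≤ suc ∣ b ∣ × ∣ b ∣ ≤ suc ∣ a ∣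
Rz-near (rrefl i) = ℕ.n≤1+n _ , ℕ.n≤1+n _
Rz-near (rdown k) = swap (∣next∣-near (+ 2 ℤ.* k))
Rz-near (rup k) rewrite two-plus k = ∣next∣-near (next (+ 2 ℤ.* k))

-- Stability of satisfaction and measures of formulas.

sat-stable : ∀ {V} φ {a} → ¬ ¬ sat V a φ → sat V a φ
sat-stable (var n) h k = h λ d → d k
sat-stable ⊥'      h   = h λ ()
sat-stable (φ ⇒ ψ) h d = sat-stable ψ λ n → h λ f → n (f d)
sat-stable (□ φ) h b r = sat-stable φ λ n → h λ f → n (f b r)
sat-stable (■ φ) h b r = sat-stable φ λ n → h λ f → n (f b r)

modal-depth : Fm → ℕ
modal-depth (var _) = 0
modal-depth ⊥'      = 0
modal-depth (φ ⇒ ψ) = modal-depth φ ℕ.⊔ modal-depth ψ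
modal-depth (□ φ)   = suc (modal-depth φ)
modal-depth (■ φ)   = suc (modal-depth φ)

var-bound : Fm → ℕ
var-bound (var n) = suc n
var-bound ⊥'      = 0
var-bound (φ ⇒ ψ) = var-bound φ ℕ.⊔ var-bound ψ
var-bound (□ φ)   = var-bound φ
var-bound (■ φ)   = var-bound φ

-- The canonical frame and what the axioms impose on it.

module CanonicalFrame (L : Fm → Set) (extends : ExtendsS4BP L) where
  open ExtendsS4BP extends
  open TenseLogic tense hiding (subst)
  open Canonical L tense public

  private
    inst : ∀ {φ} (σ : ℕ → Fm) → L φ → L (φ [ σ ])
    inst = TenseLogic.subst tense

  module Future = Modality □ nec□ (λ φ ψ → inst (instantiate φ ψ ψ) axK□)
  module Past   = Modality ■ nec■ (λ φ ψ → inst (instantiate φ ψ ψ) axK■)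

  R : World → World → Set
  R = Future.Rel

  -- If `φ` were missing at `x`, then `conv□` would put `𝖯 (¬' φ)` into `y`, against the `■ φ`
  -- there.
  R⇒Past : ∀ {x y} → R x y → Past.Rel y x
  R⇒Past {x} {y} r = Past.rel λ φ d → ∋-stable x λ n →
    Past.dia-elim y (Future.transfer r _ (mp-closed x (theorems x (inst (λ _ → ¬' φ) conv□)) (maximal x n)))
      λ z s e → ¬-elim z e (Past.transfer s φ d)

  Past⇒R : ∀ {x y} → Past.Rel y x → R x y
  Past⇒R {x} {y} r = Future.rel λ φ d → ∋-stable y λ n →
    Future.dia-elim x (Past.transfer r _ (mp-closed y (theorems y (inst (λ _ → ¬' φ) conv■)) (maximal y n)))
      λ z s e → ¬-elim z e (Future.transfer s φ d)

  R-refl : ∀ x → R x x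
  R-refl x = Future.rel λ φ d → mp-closed x (theorems x (inst (λ _ → φ) axT)) d

  R-trans : ∀ {x y z} → R x y → R y z → R x z
  R-trans {x} r s = Future.rel λ φ d → Future.transfer s φ (Future.transfer r (□ φ) (mp-closed x (theorems x (inst (λ _ → φ) ax4)) d))

  -- With `φ` separating `y` from `x` and `ψ` separating `z` from `y`, the point `y` witnesses the
  -- antecedent of `bd₂` at `x`, which forces `φ` at `x`.
  R-depth : ∀ {x y z} → R x y → R y z → ¬ R y x → ¬ R z y → ⊥
  R-depth {x} {y} {z} xy yz ¬yx ¬zy =
    Future.separate y x ¬yx λ { (φ , φ₁ , φ₂) → Future.separate z y ¬zy λ { (ψ , ψ₁ , ψ₂) →
    φ₂ (mp-closed x (theorems x (inst (instantiate ψ φ φ) axbd))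
      (Future.dia-intro x y xy (∧-intro y φ₁ (maximal y λ h →
        ψ₂ (mp-closed y h (Future.dia-intro y z yz ψ₁)))))) } }

  E : World → World → Set
  E x y = R x y × R y x

  -- Depth is self-dual, by reading a chain backwards; width of the converse comes from the axiom
  -- for the past.
  R-bounded : ∀ c → Bounded (dir c R) E
  R-bounded true = record
    { E-to = proj₁ ; E-from = proj₂ ; E-intro = _,_ ; S-refl = R-refl _ ; S-trans = R-trans
    ; stable = Future.Rel-stable _ _ ; depth = R-depth
    ; width = Future.width R-refl (λ φ ψ χ → inst (instantiate φ ψ χ) axbw⁺) _ _ _ _ }
  R-bounded false = record
    { E-to = proj₂ ; E-from = proj₁ ; E-intro = λ r s → s , r ; S-refl = R-refl _ ; S-trans = flip R-trans
    ; stable = Future.Rel-stable _ _ ; depth = λ r s n m → R-depth s r m n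
    ; width = λ ra rb rc ab ac ba bc ca cb →
        Past.width (λ v → R⇒Past (R-refl v)) (λ φ ψ χ → inst (instantiate φ ψ χ) axbw⁻) _ _ _ _
          (R⇒Past ra) (R⇒Past rb) (R⇒Past rc) (ab ∘ Past⇒R) (ac ∘ Past⇒R) (ba ∘ Past⇒R)
          (bc ∘ Past⇒R) (ca ∘ Past⇒R) (cb ∘ Past⇒R) }

  -- Distance to `p` in the canonical frame.

  Adjacent : World → World → Set
  Adjacent x y = R x y ⊎ R y x

  near : ℕ → World → Set
  near k x = x ∋ Δ^ k p

  near-step : ∀ k {x y} → Adjacent x y → near k y → near (suc k) x
  near-step k {x} {y} (inj₁ r) h = ∨-introʳ x (∨-introˡ x (Future.dia-intro x y r h))
  near-step k {x} {y} (inj₂ r) h = ∨-introʳ x (∨-introʳ x (Past.dia-intro x y (R⇒Past r) h))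

  near-elim : ∀ k x → near (suc k) x → ¬ ¬ Σ World λ y → Adjacent x y × near k y
  near-elim k x h n =
    ∨-elim x h (λ e → n (x , inj₁ (R-refl x) , e)) λ h′ →
    ∨-elim x h′ (λ e → Future.dia-elim x e λ y r e′ → n (y , inj₁ r , e′)) λ e →
    Past.dia-elim x e λ y r e′ → n (y , inj₂ (Past⇒R r) , e′)

  near-mono : ∀ {j k} x → j ≤ k → near j x → near k x
  near-mono x j≤k = go (ℕ.≤⇒≤′ j≤k)
    where
    go : ∀ {j k} → j ℕ.≤′ k → near j x → near k x
    go ℕ.≤′-refl                h = h
    go (ℕ.≤′-step {n = k} j≤′k) h = near-step k (inj₁ (R-refl x)) (go j≤′k h)

  -- By transitivity the first step towards `p` can start anywhere in the cluster; hence at least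
  -- one step is asked for.
  near-cluster : ∀ k {x w} → E x w → near (suc k) x → near (suc k) w
  near-cluster k {x} {w} (xw , wx) h = ∋-stable w λ n → near-elim k x h λ
    { (y , inj₁ r , e) → n (near-step k (inj₁ (R-trans wx r)) e)
    ; (y , inj₂ r , e) → n (near-step k (inj₂ (R-trans r xw)) e) }

  -- Distance exactly j + 2 from p: unlike p itself, these sets are unions of clusters.
  Level : ℕ → World → Set
  Level j x = near (2 + j) x × ¬ near (1 + j) x

  level-cluster : ∀ j {x w} → E x w → Level j x → Level j w
  level-cluster j e (h , n) = near-cluster (suc j) e h , λ h′ → n (near-cluster j (swap e) h′)

  levels-nonadjacent : ∀ j {x y} → Level j x → Level (2 + j) y → ¬ Adjacent y x
  levels-nonadjacent j (h , _) (_ , n) a = n (near-step (2 + j) a h)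

  level-step : ∀ j x → Level (suc j) x → ¬ ¬ Σ World λ y → Adjacent x y × Level j y
  level-step j x (h , n) = near-elim (2 + j) x h >>= λ { (y , a , e) →
    return (y , a , e , λ e′ → n (near-step (1 + j) a e′)) }

  -- Position and level are tied by an equation, which keeps subtraction out of the recursion.
  Descends : ℕ → (ℕ → World) → Set
  Descends N ρ = (∀ i j → i + j ≡ N → Level j (ρ i)) × (∀ i j → i + suc j ≡ N → Adjacent (ρ i) (ρ (suc i)))

  prepend : World → (ℕ → World) → ℕ → World
  prepend x ρ zero    = x
  prepend x ρ (suc i) = ρ i

  descent : ∀ N x → Level N x → ¬ ¬ Σ (ℕ → World) λ ρ → ρ 0 ≡ x × Descends N ρ
  descent zero x h = return ((λ _ → x) , refl , (λ { zero j refl → h ; (suc i) j () }) , λ { zero j () ; (suc i) j () })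
  descent (suc N) x h = level-step N x h >>= λ { (y , a , h′) → descent N y h′ >>= λ { (ρ , refl , lv , ad) →
    return (prepend x ρ , refl
      , (λ { zero j refl → h ; (suc i) j eq → lv i j (ℕ.suc-injective eq) })
      , (λ { zero j refl → a ; (suc i) j eq → ad i j (ℕ.suc-injective eq) })) } }

  -- A descent read backwards, so that the index of a world is its level.
  record Ascent (N : ℕ) : Set₁ where
    field
      π        : ℕ → World
      level    : ∀ j → j ≤ N → Level j (π j)
      adjacent : ∀ j → j < N → Adjacent (π j) (π (suc j))

  ascent : ∀ N x → Level N x → ¬ ¬ Ascent N
  ascent N x h = descent N x h >>= λ { (ρ , _ , lv , ad) → return record
    { π        = λ j → ρ (N ℕ.∸ j)
    ; level    = λ j j≤N → lv (N ℕ.∸ j) j (ℕ.m∸n+n≡m j≤N)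
    ; adjacent = λ j j<N → swap-adjacent (subst (λ i → Adjacent (ρ (N ℕ.∸ suc j)) (ρ i))
        (sym (ℕ.+-∸-assoc 1 j<N)) (ad (N ℕ.∸ suc j) j (ℕ.m∸n+n≡m j<N)))
    } }
    where
    swap-adjacent : ∀ {x y} → Adjacent x y → Adjacent y x
    swap-adjacent (inj₁ r) = inj₂ r
    swap-adjacent (inj₂ r) = inj₁ r

  -- `Δ^ (2 + N) p` holds on the levels up to `N` and fails on level `suc N`. Used as a premise or
  -- as a conjunct, it fixes the value on the new top level and leaves the lower ones alone.
  levels-definable : ∀ N (A : ℕ → Set) → ¬ ¬ Σ Fm λ α → ∀ j → j ≤ N → ∀ w → Level j w →
                     (¬ ¬ A j → w ∋ α) × (w ∋ α → ¬ ¬ A j)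
  levels-definable zero A = ¬¬-excluded-middle >>= λ
    { (yes a) → return (⊥' ⇒ ⊥' , λ { .0 z≤n w _ → (λ _ → ⇒-intro w id) , λ _ → return a })
    ; (no ¬a) → return (⊥' , λ { .0 z≤n w _ → (λ a → ⊥-elim (a ¬a)) , λ d → ⊥-elim (consistent w d) }) }
  levels-definable (suc N) A = levels-definable N A >>= λ { (α , spec) → ¬¬-excluded-middle >>= λ
    { (yes a) → return (Δ^ (2 + N) p ⇒ α , λ j j≤ w lv → case-top a α spec j j≤ w lv)
    ; (no ¬a) → return (Δ^ (2 + N) p ∧' α , λ j j≤ w lv → case-bot ¬a α spec j j≤ w lv) } }
    where
    Spec : ℕ → Fm → Set₁
    Spec N α = ∀ j → j ≤ N → ∀ w → Level j w → (¬ ¬ A j → w ∋ α) × (w ∋ α → ¬ ¬ A j)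
    case-top : A (suc N) → ∀ α → Spec N α → Spec (suc N) (Δ^ (2 + N) p ⇒ α)
    case-top a α spec j j≤ w lv with ℕ.m≤n⇒m<n∨m≡n j≤
    ... | inj₁ (s≤s j≤N) = (λ h → ⇒-intro w λ _ → proj₁ (spec j j≤N w lv) h)
                         , (λ d → proj₂ (spec j j≤N w lv) (mp-closed w d (near-mono w (s≤s (s≤s j≤N)) (proj₁ lv))))
    ... | inj₂ refl      = (λ _ → ⇒-intro w λ d → ⊥-elim (proj₂ lv d)) , λ _ → return a
    case-bot : ¬ A (suc N) → ∀ α → Spec N α → Spec (suc N) (Δ^ (2 + N) p ∧' α)
    case-bot ¬a α spec j j≤ w lv with ℕ.m≤n⇒m<n∨m≡n j≤
    ... | inj₁ (s≤s j≤N) = (λ h → ∧-intro w (near-mono w (s≤s (s≤s j≤N)) (proj₁ lv)) (proj₁ (spec j j≤N w lv) h))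
                         , (λ d → proj₂ (spec j j≤N w lv) (∧-elimʳ w d))
    ... | inj₂ refl      = (λ h → ⊥-elim (h ¬a)) , λ d → ⊥-elim (proj₂ lv (∧-elimˡ w d))

  -- Bounded bisimulation between an ascent and a window of 𝔊_ℤ.

  module Window (N : ℕ) (A : Ascent N) (c₀ : Bool) (edge₀ : dir c₀ R (Ascent.π A 0) (Ascent.π A 1))
                (z : ℤ) (z-parity : HasParity c₀ z) where
    open Ascent A

    side : ℕ → Bool
    side = orient c₀

    nonadjacent : ∀ i → 2 + i ≤ N → ¬ Adjacent (π (2 + i)) (π i)
    nonadjacent i i≤ = levels-nonadjacent i (level i (ℕ.≤-trans (ℕ.m≤n+m i 2) i≤)) (level (2 + i) i≤)

    -- Two consecutive edges in the same direction would compose and shorten the distance.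
    edge : ∀ j → j < N → dir (side j) R (π j) (π (suc j))
    edge zero    _   = edge₀
    edge (suc j) j<N with dir-cases (side j) (adjacent (suc j) j<N)
    ... | inj₂ r = r
    ... | inj₁ r = ⊥-elim (nonadjacent j j<N (dir-adjacent (not (side j)) (dir-not (side j)
          (Bounded.S-trans (R-bounded (side j)) (edge j (ℕ.<⇒≤ j<N)) r))))

    R-fork : ∀ i → 2 + i ≤ N → Fork (dir (side (suc i)) R)
             (λ w → E w (π i)) (λ w → E w (π (suc i))) (λ w → E w (π (2 + i)))
    R-fork i i≤ = bounded⇒fork (R-bounded (side (suc i)))
      -- Orientations alternate, so the edge into the middle, once reversed, has the direction of
      -- the edge out of it.
      (dir-not (side i) (edge i (ℕ.<⇒≤ i≤))) (edge (suc i) i≤)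
      (λ r → nonadjacent i i≤ (dir-adjacent (not (side (suc i))) (dir-not (side (suc i)) r)))
      (λ r → nonadjacent i i≤ (dir-adjacent (side (suc i)) r))

    Z-fork : ∀ i → Fork (dir (side (suc i)) Rz)
             (_≡ z ℤ.+ + i) (_≡ next (z ℤ.+ + i)) (_≡ next (next (z ℤ.+ + i)))
    Z-fork i = Rz-fork (side (suc i)) (z ℤ.+ + i) (parity-next (side i) (parity-orient c₀ z z-parity i))

    -- The number `e` of modal steps still allowed is also the margin kept to both ends of the
    -- window, because forks are known only in its interior. An integer is matched with a whole
    -- cluster.
    Similar : ℕ → ℤ → World → Set
    Similar e a w = Σ ℕ λ j → a ≡ z ℤ.+ + j × e ≤ j × j + e ≤ N × E w (π j)

    similar-at : ∀ {e i a w} → e ≤ i → suc i + suc e ≤ N →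
                 (a ≡ z ℤ.+ + i × E w (π i)) ⊎ (a ≡ next (z ℤ.+ + i) × E w (π (suc i))) ⊎
                 (a ≡ next (next (z ℤ.+ + i)) × E w (π (2 + i))) → Similar e a w
    similar-at {e} {i} lo hi (inj₁ (eq , c)) =
      i , eq , lo , ℕ.≤-trans (ℕ.+-mono-≤ (ℕ.n≤1+n i) (ℕ.n≤1+n e)) hi , c
    similar-at {e} {i} lo hi (inj₂ (inj₁ (eq , c))) =
      suc i , trans eq (sym (+-next z i)) , ℕ.m≤n⇒m≤1+n lo , ℕ.≤-trans (ℕ.+-monoʳ-≤ (suc i) (ℕ.n≤1+n e)) hi , c
    similar-at {e} {i} lo hi (inj₂ (inj₂ (eq , c))) =
      2 + i , trans eq (sym (trans (+-next z (suc i)) (cong next (+-next z i)))) ,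
      ℕ.m≤n⇒m≤1+n (ℕ.m≤n⇒m≤1+n lo) , subst (_≤ N) (ℕ.+-suc (suc i) e) hi , c

    interior : ∀ {e i} → suc i + suc e ≤ N → 2 + i ≤ N
    interior {e} {i} hi = ℕ.≤-trans (s≤s (s≤s (ℕ.m≤m+n i e))) (subst (_≤ N) (ℕ.+-suc (suc i) e) hi)

    forth : ∀ {e a w b} → Similar (suc e) a w → Rz a b → ¬ ¬ Σ World λ y → R w y × Similar e b y
    -- A positive margin makes the index a successor, hence the middle of the fork whose left arm
    -- has index `i`.
    forth (suc i , eq , s≤s lo , hi , c) r =
      respond-forward (side (suc i)) (Z-fork i) (R-fork i (interior hi)) (trans eq (+-next z i)) c r >>= λ
      { (y , r′ , m) → return (y , r′ , similar-at lo hi m) }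

    forth⁻ : ∀ {e a w b} → Similar (suc e) a w → Rz b a → ¬ ¬ Σ World λ y → R y w × Similar e b y
    forth⁻ (suc i , eq , s≤s lo , hi , c) r =
      respond-backward (side (suc i)) (Z-fork i) (R-fork i (interior hi)) (trans eq (+-next z i)) c r >>= λ
      { (y , r′ , m) → return (y , r′ , similar-at lo hi m) }

    back : ∀ {e a w y} → Similar (suc e) a w → R w y → ¬ ¬ Σ ℤ λ b → Rz a b × Similar e b y
    back (suc i , eq , s≤s lo , hi , c) r =
      respond-forward (side (suc i)) (R-fork i (interior hi)) (Z-fork i) c (trans eq (+-next z i)) r >>= λ
      { (y , r′ , m) → return (y , r′ , similar-at lo hi (Sum.map swap (Sum.map swap swap) m)) }

    back⁻ : ∀ {e a w y} → Similar (suc e) a w → R y w → ¬ ¬ Σ ℤ λ b → Rz b a × Similar e b y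
    back⁻ (suc i , eq , s≤s lo , hi , c) r =
      respond-backward (side (suc i)) (R-fork i (interior hi)) (Z-fork i) c (trans eq (+-next z i)) r >>= λ
      { (y , r′ , m) → return (y , r′ , similar-at lo hi (Sum.map swap (Sum.map swap swap) m)) }

    module Truth (V : ℕ → ℤ → Set) (n : ℕ) (σ : ℕ → Fm)
                 (σ-spec : ∀ v → v < n → ∀ j → j ≤ N → ∀ w → Level j w →
                           (¬ ¬ V v (z ℤ.+ + j) → w ∋ σ v) × (w ∋ σ v → ¬ ¬ V v (z ℤ.+ + j))) where

      -- Invariance under the bounded bisimulation and the canonical truth lemma in one induction.
      -- At a variable, `σ-spec` applies because levels are unions of clusters.
      truth : ∀ φ {e a w} → var-bound φ ≤ n → modal-depth φ ≤ e → Similar e a w →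
              (sat V a φ → w ∋ φ [ σ ]) × (w ∋ φ [ σ ] → sat V a φ)
      truth (var v) {w = w} v< _ (j , refl , _ , hi , c) =
        σ-spec v v< j j≤N w (level-cluster j {π j} (swap c) (level j j≤N))
        where j≤N = ℕ.≤-trans (ℕ.m≤m+n j _) hi
      truth ⊥' {w = w} _ _ _ = (λ ()) , consistent w
      truth (φ ⇒ ψ) {w = w} vb de s =
        (λ f → ⇒-intro w λ d → proj₁ ihψ (f (proj₂ ihφ d))) ,
        (λ d s → proj₂ ihψ (mp-closed w d (proj₁ ihφ s)))
        where
        ihφ = truth φ (ℕ.m⊔n≤o⇒m≤o _ _ vb) (ℕ.m⊔n≤o⇒m≤o _ _ de) s
        ihψ = truth ψ (ℕ.m⊔n≤o⇒n≤o (var-bound φ) _ vb) (ℕ.m⊔n≤o⇒n≤o (modal-depth φ) _ de) s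
      truth (□ φ) {w = w} vb (s≤s de) s =
        (λ h → Future.box-intro w λ y r → ∋-stable y λ k → back s r λ { (b , r′ , s′) →
          k (proj₁ (truth φ vb de s′) (h b r′)) }) ,
        (λ d b r → sat-stable φ λ k → forth s r λ { (y , r′ , s′) →
          k (proj₂ (truth φ vb de s′) (Future.transfer r′ _ d)) })
      truth (■ φ) {w = w} vb (s≤s de) s =
        (λ h → Past.box-intro w λ y r → ∋-stable y λ k → back⁻ s (Past⇒R r) λ { (b , r′ , s′) →
          k (proj₁ (truth φ vb de s′) (h b r′)) }) ,
        (λ d b r → sat-stable φ λ k → forth⁻ s r λ { (y , r′ , s′) →
          k (proj₂ (truth φ vb de s′) (Past.transfer (R⇒Past r′) _ d)) })

  -- The parity of z decides which of the two central points of the ascent is matched with x.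
  placement : ∀ D c x → Σ ℤ λ z → Σ ℕ λ m → HasParity c z × x ≡ z ℤ.+ + m × D ≤ m × m + D ≤ suc (D + D)
  placement D c x = choose c (proj₁ (parity (x ℤ.- + D))) (proj₂ (parity (x ℤ.- + D)))
    where
    z : ℤ
    z = x ℤ.- + D
    x≡z+D : x ≡ z ℤ.+ + D
    x≡z+D = sym (trans (ℤ.+-assoc x (ℤ.- + D) (+ D))
      (trans (cong (λ t → x ℤ.+ t) (ℤ.+-inverseˡ (+ D))) (ℤ.+-identityʳ x)))
    x≡pred-z+1+D : x ≡ ℤ.pred z ℤ.+ + suc D
    x≡pred-z+1+D = trans x≡z+D (sym (trans (+-next (ℤ.pred z) D)
      (trans (sym (ℤ.+-assoc (+ 1) (ℤ.pred z) (+ D))) (cong (ℤ._+ + D) (ℤ.suc-pred z)))))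
    Placed : Bool → Set
    Placed c = Σ ℤ λ z → Σ ℕ λ m → HasParity c z × x ≡ z ℤ.+ + m × D ≤ m × m + D ≤ suc (D + D)
    central : ∀ c → HasParity c z → Placed c
    central c h = z , D , h , x≡z+D , ℕ.≤-refl , ℕ.n≤1+n _
    shifted : ∀ c → HasParity c z → Placed (not c)
    shifted c h = ℤ.pred z , suc D , parity-previous c (subst (HasParity c) (sym (ℤ.suc-pred z)) h)
      , x≡pred-z+1+D , ℕ.n≤1+n D , ℕ.≤-refl
    choose : ∀ c c′ → HasParity c′ z → Placed c
    choose true  true  h = central true h
    choose true  false h = shifted false h
    choose false true  h = shifted true h
    choose false false h = central false h

  -- On the levels, `σ` defines the valuation read along the window. By closure under substitution
  -- `φ [ σ ]` lies in `π m`, and `truth` carries it back to the integer. Length 2D + 1 leaves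
  -- margin D around both central indices, D and D + 1.
  window⇒sat : ∀ φ → L φ → let D = modal-depth φ ; N = suc (D + D) in (A : Ascent N) →
               ∀ c → dir c R (Ascent.π A 0) (Ascent.π A 1) → ∀ z → HasParity c z →
               ∀ m → D ≤ m → m + D ≤ N → ∀ V → sat V (z ℤ.+ + m) φ
  window⇒sat φ Lφ A c edge₀ z z-parity m lo hi V = sat-stable φ λ k →
    ¬¬-bounded-∀ _ (var-bound φ) (λ v → levels-definable N (λ j → V v (z ℤ.+ + j))) λ definable →
    let σ , σ-spec = extract _ (var-bound φ) definable in
    k (proj₂ (Truth.truth V (var-bound φ) σ σ-spec φ ℕ.≤-refl ℕ.≤-refl
               (m , refl , lo , hi , R-refl _ , R-refl _))
             (theorems (π m) (TenseLogic.subst tense σ Lφ)))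
    where
    N : ℕ
    N = suc (modal-depth φ + modal-depth φ)
    open Ascent A
    open Window N A c edge₀ z z-parity

  -- The direction of the first edge is dictated by the canonical frame; the parity of `z` is then
  -- chosen to fit it.
  ascent⇒sat : ∀ φ → L φ → Ascent (suc (modal-depth φ + modal-depth φ)) → ∀ V x → sat V x φ
  ascent⇒sat φ Lφ A V x = from-edge (Ascent.adjacent A 0 (s≤s z≤n))
    where
    from-direction : ∀ c → dir c R (Ascent.π A 0) (Ascent.π A 1) → sat V x φ
    from-direction c edge₀ with z , m , z-parity , x≡ , lo , hi ← placement (modal-depth φ) c x =
      subst (λ a → sat V a φ) (sym x≡) (window⇒sat φ Lφ A c edge₀ z z-parity m lo hi V)
    from-edge : Adjacent (Ascent.π A 0) (Ascent.π A 1) → sat V x φ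
    from-edge (inj₁ r) = from-direction true r
    from-edge (inj₂ r) = from-direction false r

  -- A world refuting `bz (suc N)` contains its antecedent and lacks its consequent, which is
  -- precisely level `N`.
  ¬bz⇒level : ∀ N → ¬ L (bz (suc N)) → Σ World (Level N)
  ¬bz⇒level N h with consistent⇒world _ h
  ... | x , n = x , ∋-stable x (λ k → n (⇒-intro x λ d → ⊥-elim (k d))) , λ d → n (⇒-intro x λ _ → d)

  unbounded⇒⊆Ga : (∀ n → 1 ≤ n → ¬ L (bz n)) → ∀ φ → L φ → Ga φ
  unbounded⇒⊆Ga h φ Lφ V x = sat-stable φ λ k →
    let w , level = ¬bz⇒level N (h (suc N) (s≤s z≤n)) in
    ascent N w level λ A → k (ascent⇒sat φ Lφ A V x)
    where
    N : ℕ
    N = suc (modal-depth φ + modal-depth φ)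

-- Failure of `bz n` in 𝔊_ℤ.

module Refutation (n : ℕ) where
  V : ℕ → ℤ → Set
  V _ a = a ≡ + suc n

  sat-Δ : ∀ φ a b → Rz a b ⊎ Rz b a → sat V b φ → sat V a (Δ φ)
  sat-Δ φ a b (inj₁ r) h _ ¬◇ = ⊥-elim (¬◇ λ n → n b r h)
  sat-Δ φ a b (inj₂ r) h _ _  = λ n → n b r h

  next-adjacent : ∀ a → Rz a (next a) ⊎ Rz (next a) a
  next-adjacent a with parity (next a)
  ... | true  , h with Fork.left (Rz-fork true a h) refl
  ...   | _ , refl , r = inj₂ r
  next-adjacent a | false , h with Fork.left (Rz-fork false a h) refl
  ...   | _ , refl , r = inj₁ r

  sat-reachable : ∀ k j → j + k ≡ suc n → sat V (+ j) (Δ^ k p)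
  sat-reachable zero j eq = return (cong +_ (trans (sym (ℕ.+-identityʳ j)) eq))
  sat-reachable (suc k) j eq = sat-Δ (Δ^ k p) (+ j) (+ suc j) (next-adjacent (+ j))
    (sat-reachable k (suc j) (trans (sym (ℕ.+-suc j k)) eq))

  -- Each step along `Rz` changes the absolute value by at most one. The inequality is decidable, so
  -- the ¬¬ in the semantics can be discharged.
  sat⇒reachable : ∀ k a → sat V a (Δ^ k p) → suc n ≤ ∣ a ∣ + k
  sat⇒reachable zero a h = decidable-stable (suc n ℕ.≤? ∣ a ∣ + 0) λ no → h λ { refl → no (ℕ.m≤m+n (suc n) 0) }
  sat⇒reachable (suc k) a h = decidable-stable (suc n ℕ.≤? ∣ a ∣ + suc k) λ no →
    let step = λ b (b≤ : ∣ b ∣ ≤ suc ∣ a ∣) (s : sat V b (Δ^ k p)) →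
          no (ℕ.≤-trans (sat⇒reachable k b s)
            (subst (∣ b ∣ + k ≤_) (sym (ℕ.+-suc ∣ a ∣ k)) (ℕ.+-monoˡ-≤ k b≤)))
    in h (step a (ℕ.n≤1+n _)) (λ ◇s → ◇s λ b r → step b (proj₂ (Rz-near r)))
         (λ b r → step b (proj₁ (Rz-near r)))

  ¬Ga-bz : ¬ Ga (bz n)
  -- From 0 the point n + 1 is reached in n + 1 steps; reaching it in n would give n + 1 ≤ n.
  ¬Ga-bz h = ℕ.<-irrefl refl (sat⇒reachable n (+ 0) (h V (+ 0) (sat-reachable (suc n) 0 refl)))

theorem7p5 : (L : Fm → Set) → ExtendsS4BP L →
    ((∀ φ → L φ → Ga φ) → (∀ (n : ℕ) → 1 ≤ n → ¬ L (bz n)))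
    × ((∀ (n : ℕ) → 1 ≤ n → ¬ L (bz n)) → (∀ φ → L φ → Ga φ))
theorem7p5 L extends =
  (λ L⊆Ga n _ Lbz → Refutation.¬Ga-bz n (L⊆Ga (bz n) Lbz)) ,
  CanonicalFrame.unbounded⇒⊆Ga L extends
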